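{- Let $(V,E)$ be a tree, $p\ge 1$ an integer, and let $E^*$ be a set of links such that for every two distinct nodes $u,v\in V$ and every $t\in\{1,\dots,p\}$ there is exactly one link between $u$ and $v$ of weight $t$, with weights $w$ and costs $c:E^*\to\mathbb{R}_+\cup\{\infty\}$. Assume the instance is metric. If there exists $F\subseteq E^*$ with $w(F)\le p$ such that $(V,E\cup F)$ is 2-edge-connected, then there exists an optimal such $F$ (minimizing $c(F)$) in which every link has both endpoints among the corner nodes.
   Context: For a link $e$ between $u$ and $v$, $P(e)$ denotes the unique path between $u$ and $v$ in the tree $(V,E)$. A link $f$ is a shadow of a link $e$ if $w(f)\ge w(e)$ and $P(f)\subseteq P(e)$ (as edge sets). The instance is metric if (i) $c(f)\le c(e)$ whenever $f$ is a shadow of $e$, and (ii) for any three links $e=(u,v)$, $f=(v,z)$, $h=(u,z)$ (where $(a,b)$ denotes a link between $a$ and $b$) with $w(h)\ge w(e)+w(f)$ we have $c(h)\le c(e)+c(f)$. Corner nodes are the nodes of the tree of degree 1 or of degree at least 3. Costs and weights of a set are summed. -}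

module Defs where

open import Data.Nat using (ℕ; zero; suc; _≤_; _+_)
open import Data.Fin using (Fin; _≟_) renaming (_<_ to _<ᶠ_)
open import Data.Product using (Σ; ∃; ∃-syntax; _×_; _,_; proj₁; proj₂)
open import Data.Sum using (_⊎_)
open import Data.Unit using (⊤)
open import Data.List using (List; []; _∷_; length; lookup; filter; foldr; map)
open import Data.List.Membership.Propositional using (_∈_)
open import Data.List.Relation.Unary.Unique.Propositional using (Unique)
open import Relation.Binary.PropositionalEquality using (_≡_; _≢_)
open import Relation.Nullary.Decidable using (_⊎-dec_)
open import Level using (suc; zero) renaming (_⊔_ to _⊔ˡ_)

-- Cost domain.  The paper uses c : E* → ℝ₊ ∪ {∞}.  The standard library
-- has no reals, so we quantify over every commutative monoid with a total
-- order in which 0 is least and addition is monotone; ℝ₊ ∪ {∞} (with the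
-- usual + and ≤) is such a structure.

record CostDomain : Set₁ where
  infixl 6 _+ᶜ_
  infix 4 _≤ᶜ_
  field
    Cost    : Set
    _≤ᶜ_    : Cost → Cost → Set
    _+ᶜ_    : Cost → Cost → Cost
    0ᶜ      : Cost
    ≤-refl    : ∀ {x} → x ≤ᶜ x
    ≤-trans   : ∀ {x y z} → x ≤ᶜ y → y ≤ᶜ z → x ≤ᶜ z
    ≤-antisym : ∀ {x y} → x ≤ᶜ y → y ≤ᶜ x → x ≡ y
    ≤-total   : ∀ x y → (x ≤ᶜ y) ⊎ (y ≤ᶜ x)
    +-assoc    : ∀ x y z → (x +ᶜ y) +ᶜ z ≡ x +ᶜ (y +ᶜ z)
    +-comm     : ∀ x y → x +ᶜ y ≡ y +ᶜ x
    +-identityˡ : ∀ x → 0ᶜ +ᶜ x ≡ x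
    0-least    : ∀ x → 0ᶜ ≤ᶜ x
    +-monoˡ-≤  : ∀ {x y} z → x ≤ᶜ y → x +ᶜ z ≤ᶜ y +ᶜ z

-- Multigraphs on the vertex set Fin n: an edge index type I and the
-- (unordered) pair of endpoints of every edge.

Joins : ∀ {n} → Fin n × Fin n → Fin n → Fin n → Set
Joins (a , b) u v = (a ≡ u × b ≡ v) ⊎ (a ≡ v × b ≡ u)

data Walk {n} {I : Set} (ends : I → Fin n × Fin n) (ok : I → Set)
          : Fin n → Fin n → Set where
  here : ∀ {u} → Walk ends ok u u
  step : ∀ {u v w} (i : I) → ok i → Joins (ends i) u v →
         Walk ends ok v w → Walk ends ok u w

module _ {n} {I : Set} {ends : I → Fin n × Fin n} {ok : I → Set} where

  edgesOf : ∀ {u v} → Walk ends ok u v → List I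
  edgesOf here             = []
  edgesOf (step i _ _ π)   = i ∷ edgesOf π

  verticesOf : ∀ {u v} → Walk ends ok u v → List (Fin n)
  verticesOf {u} here           = u ∷ []
  verticesOf {u} (step _ _ _ π) = u ∷ verticesOf π

  laterVertices : ∀ {u v} → Walk ends ok u v → List (Fin n)
  laterVertices here           = []
  laterVertices (step _ _ _ π) = verticesOf π

  IsPath : ∀ {u v} → Walk ends ok u v → Set
  IsPath π = Unique (verticesOf π)

AllEdges : ∀ {I : Set} → I → Set
AllEdges _ = ⊤

Connected : ∀ {n} {I : Set} → (I → Fin n × Fin n) → (I → Set) → Set
Connected {n} ends ok = (u v : Fin n) → Walk ends ok u v

TwoEdgeConnected : ∀ {n} {I : Set} → (I → Fin n × Fin n) → Set
TwoEdgeConnected ends =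
  Connected ends AllEdges × (∀ i → Connected ends (λ j → j ≢ i))

IsCycle : ∀ {n} {I : Set} {ends : I → Fin n × Fin n} {v} →
          Walk ends AllEdges v v → Set
IsCycle here = Data.Empty.⊥ where import Data.Empty
IsCycle π@(step _ _ _ _) = Unique (edgesOf π) × Unique (laterVertices π)

Acyclic : ∀ {n} {I : Set} → (I → Fin n × Fin n) → Set
Acyclic {n} ends = ∀ (v : Fin n) (π : Walk ends AllEdges v v) → IsCycle π → Data.Empty.⊥
  where import Data.Empty

Edges : ℕ → Set
Edges n = List (Fin n × Fin n)

treeEnds : ∀ {n} (E : Edges n) → Fin (length E) → Fin n × Fin n
treeEnds E = lookup E

IsTree : ∀ {n} → Edges n → Set
IsTree E = Connected (treeEnds E) AllEdges × Acyclic (treeEnds E)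

degree : ∀ {n} → Edges n → Fin n → ℕ
degree E v = length (filter (λ e → (v ≟ proj₁ e) ⊎-dec (v ≟ proj₂ e)) E)

Corner : ∀ {n} → Edges n → Fin n → Set
Corner E v = degree E v ≡ 1 ⊎ 3 ≤ degree E v

-- Links.  E* contains, for every two distinct nodes u,v and every
-- t ∈ {1,…,p}, exactly one link between u and v of weight t.  We
-- represent the link by its endpoints in increasing order and its weight.

record Link (n p : ℕ) : Set where
  constructor link
  field
    end₁ end₂ : Fin n
    ordered   : end₁ <ᶠ end₂
    weight    : ℕ
    weight≥1  : 1 ≤ weight
    weight≤p  : weight ≤ p
open Link public

linkEnds : ∀ {n p} → Link n p → Fin n × Fin n
linkEnds e = end₁ e , end₂ e

Between : ∀ {n p} → Link n p → Fin n → Fin n → Set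
Between e a b = Joins (linkEnds e) a b

InP : ∀ {n p} (E : Edges n) → Link n p → Fin (length E) → Set
InP E e i = Σ (Walk (treeEnds E) AllEdges (end₁ e) (end₂ e))
              (λ π → IsPath π × i ∈ edgesOf π)

Shadow : ∀ {n p} (E : Edges n) → Link n p → Link n p → Set
Shadow E f e = weight e ≤ weight f × (∀ i → InP E f i → InP E e i)

module _ (D : CostDomain) where
  open CostDomain D

  Metric : ∀ {n p} → Edges n → (Link n p → Cost) → Set
  Metric {n} {p} E c =
    (∀ (e f : Link n p) → Shadow E f e → c f ≤ᶜ c e) ×
    (∀ (e f h : Link n p) (u v z : Fin n) →
       Between e u v → Between f v z → Between h u z →
       weight e + weight f ≤ weight h → c h ≤ᶜ c e +ᶜ c f)

  costOf : ∀ {n p} → (Link n p → Cost) → List (Link n p) → Cost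
  costOf c F = foldr (λ e s → c e +ᶜ s) 0ᶜ F

weightOf : ∀ {n p} → List (Link n p) → ℕ
weightOf F = foldr (λ e s → weight e + s) 0 F

unionEnds : ∀ {n p} (E : Edges n) (F : List (Link n p)) →
            Fin (length E) ⊎ Fin (length F) → Fin n × Fin n
unionEnds E F (Data.Sum.inj₁ i) = lookup E i
unionEnds E F (Data.Sum.inj₂ j) = linkEnds (lookup F j)

Feasible : ∀ {n p} → Edges n → List (Link n p) → Set
Feasible {p = p} E F = Unique F × weightOf F ≤ p × TwoEdgeConnected (unionEnds E F)

{-# OPTIONS --safe #-}
module Submission where

-- A tree edge i splits the tree into two sides, and E ∪ F is 2-edge-connected iff every tree edge
-- is crossed by a link of F. Start from a cheapest such F. Let e ∈ F join x to a node v of degree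
-- two, starting along the tree edge i, and let j be the other edge at v; some f ∈ F crosses j.
-- If f ends at v, then e and f use disjoint paths and are merged into one link of weight
-- w(e) + w(f). Otherwise f passes through v and also covers i, so e can be replaced by its shadow
-- starting at the other end of i. Neither step increases cost or weight, and both decrease the
-- number of links plus the total length of their paths.

open import Defs
open import Data.Bool using (Bool; true; false)
import Data.Bool.Properties as Bool
open import Data.Fin as Fin using (Fin; zero; suc; _≟_)
import Data.Fin.Properties as Fin
open import Data.List
  using (List; []; _∷_; _++_; length; lookup; filter; concatMap; upTo; allFin; cartesianProductWith;
         deduplicate)
open import Data.List.Membership.Propositional using (_∈_; _∉_; lose; find)
open import Data.List.Membership.Propositional.Properties
  using (∈-∃++; ∈-concatMap⁺; ∈-upTo⁺; ∈-allFin; ∈-cartesianProductWith⁺; ∈-filter⁺;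
         ∈-lookup; ∈-deduplicate⁺; ∈-deduplicate⁻)
import Data.List.Extrema as Extrema
open import Data.List.Relation.Binary.Permutation.Propositional
  using (_↭_; refl; prep; swap; trans)
open import Data.List.Relation.Binary.Permutation.Propositional.Properties
  using (shift; Any-resp-↭; ∈-resp-↭)
open import Data.List.Relation.Unary.All as All using (All; []; _∷_)
import Data.List.Relation.Unary.All.Properties as All
open import Data.List.Relation.Unary.Any as Any using (Any; here; there; any?)
import Data.List.Relation.Unary.Any.Properties as Any
open import Data.List.Relation.Unary.AllPairs using ([]; _∷_)
open import Data.List.Relation.Unary.Unique.Propositional using (Unique)
import Data.List.Relation.Unary.Unique.DecPropositional.Properties as Unique
open import Data.Nat using (ℕ; zero; suc; _+_; _≤_; _<_; z≤n; s≤s; _≤?_)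
import Data.Nat.Properties as ℕ
open import Data.Nat.Induction using (<-wellFounded; Acc; acc)
open import Data.Product using (Σ; ∃; _×_; _,_; proj₁; proj₂)
open import Data.Sum as Sum using (_⊎_; inj₁; inj₂; [_,_]′)
open import Data.Unit using (tt)
open import Function using (_∘_; id)
open import Level using (0ℓ)
open import Relation.Binary using (TotalOrder; tri<; tri≈; tri>; DecidableEquality)
open import Relation.Nullary using (¬_; Dec; yes; no; contradiction; ¬?)
open import Relation.Nullary.Decidable using (_×-dec_; _⊎-dec_; map′)
open import Relation.Unary using (Decidable)
open import Relation.Binary.PropositionalEquality as ≡ using (_≡_; _≢_; refl; sym; cong; cong₂; subst)

-- Booleans, and lists with at most two elements satisfying a predicate.

Bool-≢≢⇒≡ : ∀ {x y z : Bool} → x ≢ y → y ≢ z → x ≡ z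
Bool-≢≢⇒≡ {y = y} x≢y y≢z = ≡.trans (Bool.¬-not x≢y) (sym (Bool.¬-not (y≢z ∘ sym)))

module _ {A : Set} {P : A → Set} (P? : ∀ x → Dec (P x)) where

  length-filter-0 : ∀ xs → length (filter P? xs) ≡ 0 → ∀ k → ¬ P (lookup xs k)
  length-filter-0 (x ∷ xs) eq k with P? x
  length-filter-0 (x ∷ xs) eq zero    | no ¬px = ¬px
  length-filter-0 (x ∷ xs) eq (suc k) | no ¬px = length-filter-0 xs eq k

  length-filter-1 : ∀ xs → length (filter P? xs) ≡ 1 →
    ∃ λ i → P (lookup xs i) × (∀ k → P (lookup xs k) → k ≡ i)
  length-filter-1 (x ∷ xs) eq with P? x
  ... | yes px = zero , px , λ where
    zero    _ → refl
    (suc k) p → contradiction p (length-filter-0 xs (ℕ.suc-injective eq) k)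
  ... | no ¬px with length-filter-1 xs eq
  ...   | i , pi , only = suc i , pi , λ where
    zero    p → contradiction p ¬px
    (suc k) p → cong suc (only k p)

  length-filter-2 : ∀ xs → length (filter P? xs) ≡ 2 →
    ∃ λ i → ∃ λ j → i ≢ j × P (lookup xs i) × P (lookup xs j) ×
                    (∀ k → P (lookup xs k) → k ≡ i ⊎ k ≡ j)
  length-filter-2 (x ∷ xs) eq with P? x
  ... | yes px with length-filter-1 xs (ℕ.suc-injective eq)
  ...   | j , pj , only = zero , suc j , (λ ()) , px , pj , λ where
    zero    _ → inj₁ refl
    (suc k) p → inj₂ (cong suc (only k p))
  length-filter-2 (x ∷ xs) eq | no ¬px with length-filter-2 xs eq
  ... | i , j , i≢j , pi , pj , only =
    suc i , suc j , (λ { refl → i≢j refl }) , pi , pj , λ where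
      zero    p → contradiction p ¬px
      (suc k) p → Sum.map (cong suc) (cong suc) (only k p)

-- Walks and paths in multigraphs.

Joins-sym : ∀ {n} {p : Fin n × Fin n} {u v} → Joins p u v → Joins p v u
Joins-sym = Sum.swap

module _ {n} {I : Set} {ends : I → Fin n × Fin n} where

  infixr 5 _++ʷ_
  _++ʷ_ : ∀ {ok : I → Set} {u v w} → Walk ends ok u v → Walk ends ok v w → Walk ends ok u w
  here         ++ʷ ρ = ρ
  step i o J π ++ʷ ρ = step i o J (π ++ʷ ρ)

  reverseʷ : ∀ {ok : I → Set} {u v} → Walk ends ok u v → Walk ends ok v u
  reverseʷ here           = here
  reverseʷ (step i o J π) = reverseʷ π ++ʷ step i o (Joins-sym J) here

  mapʷ : ∀ {J : Set} {ends′ : J → Fin n × Fin n} {ok : I → Set} {ok′ : J → Set}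
         (g : I → J) → (∀ i → ends′ (g i) ≡ ends i) → (∀ i → ok i → ok′ (g i)) →
         ∀ {u v} → Walk ends ok u v → Walk ends′ ok′ u v
  mapʷ g eq k here           = here
  mapʷ g eq k (step i o J π) =
    step (g i) (k i o) (subst (λ p → Joins p _ _) (sym (eq i)) J) (mapʷ g eq k π)

  avoiding : ∀ {ok : I → Set} {i u v} (π : Walk ends ok u v) → i ∉ edgesOf π →
             Walk ends (_≢ i) u v
  avoiding here           _   = here
  avoiding (step j _ J π) i∉π =
    step j (λ j≡i → i∉π (here (sym j≡i))) J (avoiding π (i∉π ∘ there))

  invariant : ∀ {ok : I → Set} {A : Set} (f : Fin n → A) →
              (∀ i → ok i → ∀ {u v} → Joins (ends i) u v → f u ≡ f v) →
              ∀ {u v} → Walk ends ok u v → f u ≡ f v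
  invariant f inv here           = refl
  invariant f inv (step i o J π) = ≡.trans (inv i o J) (invariant f inv π)

  module _ {ok : I → Set} where

    source∈ : ∀ {u v} (π : Walk ends ok u v) → u ∈ verticesOf π
    source∈ here           = here refl
    source∈ (step _ _ _ _) = here refl

    Path : Fin n → Fin n → Set
    Path u v = Σ (Walk ends ok u v) IsPath

    suffix : ∀ {u v x} (π : Walk ends ok u v) → IsPath π → x ∈ verticesOf π → Path x v
    suffix here               p       (here refl) = here , p
    suffix π@(step _ _ _ _)   p       (here refl) = π , p
    suffix (step _ _ _ π)     (_ ∷ p) (there x∈π) = suffix π p x∈π

    loopErase : ∀ {u v} → Walk ends ok u v → Path u v
    loopErase here = here , [] ∷ []
    loopErase {u} (step i o J π) with loopErase π
    ... | π′ , p with any? (u ≟_) (verticesOf π′)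
    ...   | yes u∈π′ = suffix π′ p u∈π′
    ...   | no  u∉π′ = step i o J π′ , All.¬Any⇒All¬ _ u∉π′ ∷ p

    edge-visits : ∀ {u v i x y} (π : Walk ends ok u v) → i ∈ edgesOf π →
                  Joins (ends i) x y → x ∈ verticesOf π
    edge-visits (step _ _ (inj₁ (refl , refl)) π) (here refl) (inj₁ (refl , _)) = here refl
    edge-visits (step _ _ (inj₁ (refl , refl)) π) (here refl) (inj₂ (_ , refl)) = there (source∈ π)
    edge-visits (step _ _ (inj₂ (refl , refl)) π) (here refl) (inj₁ (refl , _)) = there (source∈ π)
    edge-visits (step _ _ (inj₂ (refl , refl)) π) (here refl) (inj₂ (_ , refl)) = here refl
    edge-visits (step _ _ _ π) (there i∈π) J = there (edge-visits π i∈π J)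

    IsPath⇒Unique-edges : ∀ {u v} (π : Walk ends ok u v) → IsPath π →
                          Unique (edgesOf π)
    IsPath⇒Unique-edges here _ = []
    IsPath⇒Unique-edges (step i o J π) (u∉π ∷ p) =
      All.¬Any⇒All¬ _ (λ i∈π → All.All¬⇒¬Any u∉π (edge-visits π i∈π J))
      ∷ IsPath⇒Unique-edges π p

    edges-ok : ∀ {u v} (π : Walk ends ok u v) → All ok (edgesOf π)
    edges-ok here           = []
    edges-ok (step _ o _ π) = o ∷ edges-ok π

    forget : ∀ {u v} → Walk ends ok u v → Walk ends AllEdges u v
    forget = mapʷ (λ i → i) (λ _ → refl) (λ _ _ → tt)

    edgesOf-forget : ∀ {u v} (π : Walk ends ok u v) → edgesOf (forget π) ≡ edgesOf π
    edgesOf-forget here           = refl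
    edgesOf-forget (step i _ _ π) = cong (i ∷_) (edgesOf-forget π)

    verticesOf-forget : ∀ {u v} (π : Walk ends ok u v) → verticesOf (forget π) ≡ verticesOf π
    verticesOf-forget here           = refl
    verticesOf-forget (step _ _ _ π) = cong (_ ∷_) (verticesOf-forget π)

-- The cut defined by a tree edge.

module Tree {n} (E : Edges n) (tree : IsTree E) where

  ends : Fin (length E) → Fin n × Fin n
  ends = treeEnds E

  Avoiding : Fin (length E) → Fin n → Fin n → Set
  Avoiding i = Walk ends (_≢ i)

  -- Loop-erasing a walk that avoids `i` and closing it up with `i` itself would produce a cycle of
  -- the tree.
  ends-separated : ∀ i → ¬ Avoiding i (proj₁ (ends i)) (proj₂ (ends i))
  ends-separated i ω with loopErase ω
  ... | π , p = proj₂ tree _ (step i tt (inj₂ (refl , refl)) (forget π))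
    ( subst (Unique ∘ (i ∷_)) (sym (edgesOf-forget π))
        (All.map (_∘ sym) (edges-ok π) ∷ IsPath⇒Unique-edges π p)
    , subst Unique (sym (verticesOf-forget π)) p )

  -- A walk towards the first end of `i` is cut just before its first use of `i`; by then it has
  -- reached one of the two ends.
  half : ∀ i u → Avoiding i u (proj₁ (ends i)) ⊎ Avoiding i u (proj₂ (ends i))
  half i u = cut (proj₁ tree u (proj₁ (ends i)))
    where
    cut : ∀ {u} → Walk ends AllEdges u (proj₁ (ends i)) →
          Avoiding i u (proj₁ (ends i)) ⊎ Avoiding i u (proj₂ (ends i))
    cut here = inj₁ here
    cut (step j _ J π) with j ≟ i
    ... | no j≢i = Sum.map (step j j≢i J) (step j j≢i J) (cut π)
    cut (step _ _ (inj₁ (refl , _)) _) | yes refl = inj₁ here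
    cut (step _ _ (inj₂ (_ , refl)) _) | yes refl = inj₂ here

  -- The component of (V, E ∖ i) containing u.
  side : Fin (length E) → Fin n → Bool
  side i u = [ (λ _ → true) , (λ _ → false) ]′ (half i u)

  -- `half` depends on the walk that was picked, so independence of that choice has to come from
  -- `ends-separated`: different verdicts for `u` and `v` would connect the ends of `i` without
  -- using `i`.
  Avoiding⇒side≡ : ∀ {i u v} → Avoiding i u v → side i u ≡ side i v
  Avoiding⇒side≡ {i} {u} {v} ω with half i u | half i v
  ... | inj₁ _ | inj₁ _ = refl
  ... | inj₂ _ | inj₂ _ = refl
  ... | inj₁ α | inj₂ β = contradiction (reverseʷ α ++ʷ ω ++ʷ β) (ends-separated i)
  ... | inj₂ β | inj₁ α = contradiction (reverseʷ α ++ʷ reverseʷ ω ++ʷ β) (ends-separated i)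

  side≡⇒Avoiding : ∀ {i u v} → side i u ≡ side i v → Avoiding i u v
  side≡⇒Avoiding {i} {u} {v} eq with half i u | half i v
  ... | inj₁ α | inj₁ β = α ++ʷ reverseʷ β
  ... | inj₂ α | inj₂ β = α ++ʷ reverseʷ β
  side≡⇒Avoiding () | inj₁ _ | inj₂ _
  side≡⇒Avoiding () | inj₂ _ | inj₁ _

  -- This is membership of `i` in the tree path from `u` to `v`, by `∈path⇒Cross` and
  -- `Cross⇒∈edges`. As a comparison of Booleans it is decidable, and path arguments become chains
  -- of equalities.
  Cross : Fin (length E) → Fin n → Fin n → Set
  Cross i u v = side i u ≢ side i v

  cross? : ∀ i u v → Dec (Cross i u v)
  cross? i u v = ¬? (side i u Bool.≟ side i v)

  edge-crosses-itself : ∀ {i u v} → Joins (ends i) u v → Cross i u v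
  edge-crosses-itself {i} (inj₁ (refl , refl)) = ends-separated i ∘ side≡⇒Avoiding
  edge-crosses-itself {i} (inj₂ (refl , refl)) = ends-separated i ∘ side≡⇒Avoiding ∘ sym

  edge-crosses-only-itself : ∀ {i j u v} → j ≢ i → Joins (ends j) u v → side i u ≡ side i v
  edge-crosses-only-itself j≢i J = Avoiding⇒side≡ (step _ j≢i J here)

  side≡-away-from-edge : ∀ {ok : Fin (length E) → Set} {i u v x y} → Joins (ends i) x y →
    (π : Walk ends ok u v) → x ∉ verticesOf π → side i u ≡ side i v
  side≡-away-from-edge J π x∉π =
    Avoiding⇒side≡ (avoiding π (λ i∈π → x∉π (edge-visits π i∈π J)))

  -- A path never returns to a vertex it has left, so it uses `i` just once and changes side there
  -- and nowhere else.
  ∈path⇒Cross : ∀ {ok : Fin (length E) → Set} {i u v} (π : Walk ends ok u v) → IsPath π →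
                i ∈ edgesOf π → Cross i u v
  ∈path⇒Cross (step i _ J π) (u∉π ∷ _) (here refl) =
    λ eq → edge-crosses-itself J
      (≡.trans eq (sym (side≡-away-from-edge J π (All.All¬⇒¬Any u∉π))))
  ∈path⇒Cross {i = i} (step j _ J π) (u∉π ∷ p) (there i∈π) =
    λ eq → ∈path⇒Cross π p i∈π (≡.trans (sym (edge-crosses-only-itself j≢i J)) eq)
    where
    j≢i : j ≢ i
    j≢i refl = All.All¬⇒¬Any u∉π (edge-visits π i∈π J)

  Cross⇒∈edges : ∀ {ok : Fin (length E) → Set} {i u v} (π : Walk ends ok u v) → Cross i u v →
                 i ∈ edgesOf π
  Cross⇒∈edges {i = i} π u×v with any? (i ≟_) (edgesOf π)
  ... | yes i∈π = i∈π
  ... | no  i∉π = contradiction (Avoiding⇒side≡ (avoiding π i∉π)) u×v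

  -- If j lay on both paths, a walk from x to z on the far side of j would use k,
  -- whose endpoint v is on the near side.
  crossings-disjoint : ∀ {k v u x z} → Joins (ends k) v u →
    Cross k v x → side k v ≡ side k z → ∀ j → Cross j v x → side j v ≡ side j z
  crossings-disjoint {k} {v} {u} {x} {z} J kx kz j jx with side j v Bool.≟ side j z
  ... | yes jz = jz
  ... | no  jz = contradiction (Cross⇒∈edges ω (kx ∘ ≡.trans kz ∘ sym)) (k∉ ω)
    where
    ω : Avoiding j x z
    ω = side≡⇒Avoiding (Bool-≢≢⇒≡ (jx ∘ sym) jz)

    side-constant : ∀ {a b y} (π : Avoiding j a b) → y ∈ verticesOf π → side j a ≡ side j y
    side-constant here (here refl) = refl
    side-constant (step _ _ _ _) (here refl) = refl
    side-constant (step i i≢j J′ π) (there y∈π) =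
      ≡.trans (edge-crosses-only-itself i≢j J′) (side-constant π y∈π)

    k∉ : (π : Avoiding j x z) → k ∉ edgesOf π
    k∉ π k∈π = jx (sym (side-constant π (edge-visits π k∈π J)))

  -- Nodes of degree two.

  incident⇒Joins : ∀ {v} {e : Fin n × Fin n} → v ≡ proj₁ e ⊎ v ≡ proj₂ e → ∃ (Joins e v)
  incident⇒Joins (inj₁ refl) = _ , inj₁ (refl , refl)
  incident⇒Joins (inj₂ refl) = _ , inj₂ (refl , refl)

  Joins⇒incident : ∀ {v u} {e : Fin n × Fin n} → Joins e v u → v ≡ proj₁ e ⊎ v ≡ proj₂ e
  Joins⇒incident = Sum.map (sym ∘ proj₁) (sym ∘ proj₂)

  -- The two edges are ordered: later arguments take the link to leave `v` along the first one, and
  -- `DegreeTwo-sym` supplies the other case.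
  record DegreeTwo (v : Fin n) (i j : Fin (length E)) : Set where
    field
      distinct : i ≢ j
      fst      : ∃ (Joins (ends i) v)
      snd      : ∃ (Joins (ends j) v)
      only     : ∀ {k u} → Joins (ends k) v u → k ≡ i ⊎ k ≡ j

  DegreeTwo-sym : ∀ {v i j} → DegreeTwo v i j → DegreeTwo v j i
  DegreeTwo-sym d = record
    { distinct = distinct ∘ sym ; fst = snd ; snd = fst ; only = Sum.swap ∘ only }
    where open DegreeTwo d

  incident? : ∀ (v : Fin n) (e : Fin n × Fin n) → Dec (v ≡ proj₁ e ⊎ v ≡ proj₂ e)
  incident? v e = (v ≟ proj₁ e) ⊎-dec (v ≟ proj₂ e)

  -- The walk from `v` to another node `x` excludes degree 0, so only degree 2 remains.
  ¬Corner⇒DegreeTwo : ∀ {v x} → v ≢ x → ¬ Corner E v → ∃ λ i → ∃ (DegreeTwo v i)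
  ¬Corner⇒DegreeTwo {v} {x} v≢x ¬corner
    with degree E v in eq | proj₁ tree v x
  ... | _ | here = contradiction refl v≢x
  ... | 0 | step i _ J _ =
    contradiction (Joins⇒incident J) (length-filter-0 (incident? v) E eq i)
  ... | 1 | _ = contradiction (inj₁ refl) ¬corner
  ... | suc (suc (suc _)) | _ = contradiction (inj₂ (s≤s (s≤s (s≤s z≤n)))) ¬corner
  ... | 2 | _ with length-filter-2 (incident? v) E eq
  ...   | i , j , i≢j , pi , pj , only = i , j , record
    { distinct = i≢j
    ; fst      = incident⇒Joins pi
    ; snd      = incident⇒Joins pj
    ; only     = λ J → only _ (Joins⇒incident J)
    }

  -- The path from `v` to `x` starts along one of the two edges and never comes back to `v`, so it
  -- cannot use the other.
  crosses-one : ∀ {v x i j} → DegreeTwo v i j → v ≢ x →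
    (Cross i v x × side j v ≡ side j x) ⊎ (Cross j v x × side i v ≡ side i x)
  crosses-one {v} {x} d v≢x with loopErase (proj₁ tree v x)
  ... | here , _ = contradiction refl v≢x
  ... | π@(step k _ J ρ) , p@(v∉ρ ∷ _) with DegreeTwo.only d J
  ...   | inj₁ refl = inj₁ (∈path⇒Cross π p (here refl) ,
      ≡.trans (edge-crosses-only-itself (DegreeTwo.distinct d) J)
            (side≡-away-from-edge (proj₂ (DegreeTwo.snd d)) ρ (All.All¬⇒¬Any v∉ρ)))
  ...   | inj₂ refl = inj₂ (∈path⇒Cross π p (here refl) ,
      ≡.trans (edge-crosses-only-itself (DegreeTwo.distinct d ∘ sym) J)
            (side≡-away-from-edge (proj₂ (DegreeTwo.fst d)) ρ (All.All¬⇒¬Any v∉ρ)))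

-- Counting by filtered lists.

module _ {A : Set} {P Q : A → Set} (P? : Decidable P) (Q? : Decidable Q)
         (P⊆Q : ∀ {x} → P x → Q x) where

  length-filter-mono : ∀ xs → length (filter P? xs) ≤ length (filter Q? xs)
  length-filter-mono [] = z≤n
  length-filter-mono (x ∷ xs) with P? x | Q? x
  ... | yes _  | yes _  = s≤s (length-filter-mono xs)
  ... | yes px | no ¬qx = contradiction (P⊆Q px) ¬qx
  ... | no _   | yes _  = ℕ.m≤n⇒m≤1+n (length-filter-mono xs)
  ... | no _   | no _   = length-filter-mono xs

  length-filter-strict : ∀ {x xs} → x ∈ xs → ¬ P x → Q x →
                         length (filter P? xs) < length (filter Q? xs)
  length-filter-strict {x} {y ∷ xs} x∈ ¬px qx with P? y | Q? y | x∈
  ... | yes py | _      | here refl = contradiction py ¬px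
  ... | no _   | no ¬qy | here refl = contradiction qx ¬qy
  ... | no _   | yes _  | _         = s≤s (length-filter-mono xs)
  ... | yes py | no ¬qy | there _   = contradiction (P⊆Q py) ¬qy
  ... | yes _  | yes _  | there i   = s≤s (length-filter-strict i ¬px qx)
  ... | no _   | no _   | there i   = length-filter-strict i ¬px qx

module _ {A : Set} {P Q R : A → Set} (P? : Decidable P) (Q? : Decidable Q) (R? : Decidable R)
         (P⊆Q∪R : ∀ {x} → P x → Q x ⊎ R x) where

  length-filter-∪ : ∀ xs → length (filter P? xs) ≤ length (filter Q? xs) + length (filter R? xs)
  length-filter-∪ [] = z≤n
  length-filter-∪ (x ∷ xs) with length-filter-∪ xs | P? x | Q? x | R? x
  ... | ih | no _   | no _   | no _   = ih
  ... | ih | no _   | no _   | yes _  = ℕ.≤-trans ih (ℕ.+-monoʳ-≤ _ (ℕ.n≤1+n _))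
  ... | ih | no _   | yes _  | no _   = ℕ.m≤n⇒m≤1+n ih
  ... | ih | no _   | yes _  | yes _  =
    ℕ.m≤n⇒m≤1+n (ℕ.≤-trans ih (ℕ.+-monoʳ-≤ _ (ℕ.n≤1+n _)))
  ... | ih | yes _  | yes _  | no _   = s≤s ih
  ... | ih | yes _  | yes _  | yes _  = s≤s (ℕ.≤-trans ih (ℕ.+-monoʳ-≤ _ (ℕ.n≤1+n _)))
  ... | ih | yes _  | no _   | yes _  = ℕ.≤-trans (s≤s ih) (ℕ.≤-reflexive (sym (ℕ.+-suc _ _)))
  ... | _  | yes px | no ¬qx | no ¬rx = contradiction (P⊆Q∪R px) [ ¬qx , ¬rx ]′

-- Rearranging lists of links, and their costs.

∈⇒↭ : ∀ {A : Set} {x : A} {xs} → x ∈ xs → ∃ λ ys → xs ↭ x ∷ ys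
∈⇒↭ x∈xs with ∈-∃++ x∈xs
... | ys , zs , refl = ys ++ zs , shift _ ys zs

module Costs (D : CostDomain) {n p : ℕ} (c : Link n p → CostDomain.Cost D) where
  open CostDomain D

  +-monoʳ-≤ : ∀ {x y} z → x ≤ᶜ y → z +ᶜ x ≤ᶜ z +ᶜ y
  +-monoʳ-≤ {x} {y} z x≤y rewrite +-comm z x | +-comm z y = +-monoˡ-≤ z x≤y

  x≤y+x : ∀ x y → x ≤ᶜ y +ᶜ x
  x≤y+x x y = subst (_≤ᶜ y +ᶜ x) (+-identityˡ x) (+-monoˡ-≤ x (0-least y))

  costOf-++ : ∀ F G → costOf D c (F ++ G) ≡ costOf D c F +ᶜ costOf D c G
  costOf-++ []      G = sym (+-identityˡ _)
  costOf-++ (e ∷ F) G = ≡.trans (cong (c e +ᶜ_) (costOf-++ F G)) (sym (+-assoc _ _ _))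

  costOf-↭ : ∀ {F G} → F ↭ G → costOf D c F ≡ costOf D c G
  costOf-↭ refl = refl
  costOf-↭ (prep e F↭G) = cong (c e +ᶜ_) (costOf-↭ F↭G)
  costOf-↭ (swap e f F↭G) = ≡.trans (sym (+-assoc _ _ _))
    (≡.trans (cong₂ _+ᶜ_ (+-comm _ _) (costOf-↭ F↭G)) (+-assoc _ _ _))
  costOf-↭ (trans F↭G G↭H) = ≡.trans (costOf-↭ F↭G) (costOf-↭ G↭H)

  costOf-replace : ∀ {F} old new {rest} → F ↭ old ++ rest → costOf D c new ≤ᶜ costOf D c old →
                   costOf D c (new ++ rest) ≤ᶜ costOf D c F
  costOf-replace old new {rest} F↭ new≤old
    rewrite costOf-↭ F↭ | costOf-++ old rest | costOf-++ new rest = +-monoˡ-≤ _ new≤old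

  costOf-singleton : ∀ e → costOf D c (e ∷ []) ≡ c e
  costOf-singleton e = ≡.trans (+-comm _ _) (+-identityˡ _)

  costOf-filter : ∀ {P : Link n p → Set} (P? : Decidable P) F →
                  costOf D c (filter P? F) ≤ᶜ costOf D c F
  costOf-filter P? [] = ≤-refl
  costOf-filter P? (e ∷ F) with P? e
  ... | yes _ = +-monoʳ-≤ (c e) (costOf-filter P? F)
  ... | no  _ = ≤-trans (costOf-filter P? F) (x≤y+x _ _)

  costOf-deduplicate : (_≟ˡ_ : DecidableEquality (Link n p)) → ∀ F →
                       costOf D c (deduplicate _≟ˡ_ F) ≤ᶜ costOf D c F
  costOf-deduplicate _≟ˡ_ [] = ≤-refl
  costOf-deduplicate _≟ˡ_ (e ∷ F) =
    +-monoʳ-≤ (c e) (≤-trans (costOf-filter _ (deduplicate _≟ˡ_ F)) (costOf-deduplicate _≟ˡ_ F))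

  totalOrder : TotalOrder 0ℓ 0ℓ 0ℓ
  totalOrder = record
    { Carrier = Cost ; _≈_ = _≡_ ; _≤_ = _≤ᶜ_
    ; isTotalOrder = record
      { isPartialOrder = record
        { isPreorder = record
          { isEquivalence = ≡.isEquivalence
          ; reflexive     = λ { refl → ≤-refl }
          ; trans         = ≤-trans
          }
        ; antisym = ≤-antisym
        }
      ; total = ≤-total
      }
    }

-- In this domain costOf weight is weightOf, so facts about costs apply to weights as well.
ℕ-costs : CostDomain
ℕ-costs = record
  { Cost = ℕ ; _≤ᶜ_ = _≤_ ; _+ᶜ_ = _+_ ; 0ᶜ = 0
  ; ≤-refl = ℕ.≤-refl ; ≤-trans = ℕ.≤-trans ; ≤-antisym = ℕ.≤-antisym ; ≤-total = ℕ.≤-total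
  ; +-assoc = ℕ.+-assoc ; +-comm = ℕ.+-comm ; +-identityˡ = ℕ.+-identityˡ
  ; 0-least = λ _ → z≤n ; +-monoˡ-≤ = λ z x≤y → ℕ.+-monoˡ-≤ z x≤y }

-- Links, and a finite enumeration of the candidate solutions.

module _ {n p : ℕ} where

  link-≡ : ∀ {e f : Link n p} → end₁ e ≡ end₁ f → end₂ e ≡ end₂ f → weight e ≡ weight f → e ≡ f
  link-≡ {link _ _ o _ l u} {link _ _ o′ _ l′ u′} refl refl refl
    rewrite ℕ.<-irrelevant o o′ | ℕ.≤-irrelevant l l′ | ℕ.≤-irrelevant u u′ = refl

  _≟ˡ_ : DecidableEquality (Link n p)
  e ≟ˡ f = map′ (λ (a , b , w) → link-≡ a b w) (λ { refl → refl , refl , refl })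
    (end₁ e ≟ end₁ f ×-dec end₂ e ≟ end₂ f ×-dec weight e ℕ.≟ weight f)

  makeLink : ∀ {u v : Fin n} {t} → u ≢ v → 1 ≤ t → t ≤ p →
             Σ (Link n p) λ e → Between e u v × weight e ≡ t
  makeLink {u} {v} u≢v 1≤t t≤p with Fin.<-cmp u v
  ... | tri< u<v _ _ = link u v u<v _ 1≤t t≤p , inj₁ (refl , refl) , refl
  ... | tri≈ _ u≡v _ = contradiction u≡v u≢v
  ... | tri> _ _ v<u = link v u v<u _ 1≤t t≤p , inj₂ (refl , refl) , refl

  linksFrom : Fin n → Fin n → ℕ → List (Link n p)
  linksFrom u v t with u Fin.<? v | 1 ≤? t | t ≤? p
  ... | yes u<v | yes 1≤t | yes t≤p = link u v u<v t 1≤t t≤p ∷ []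
  ... | _       | _       | _       = []

  ∈-linksFrom : ∀ e → e ∈ linksFrom (end₁ e) (end₂ e) (weight e)
  ∈-linksFrom (link u v u<v t 1≤t t≤p) with u Fin.<? v | 1 ≤? t | t ≤? p
  ... | yes _   | yes _   | yes _   = here (link-≡ refl refl refl)
  ... | no u≮v  | _       | _       = contradiction u<v u≮v
  ... | yes _   | no 1≰t  | _       = contradiction 1≤t 1≰t
  ... | yes _   | yes _   | no t≰p  = contradiction t≤p t≰p

  allLinks : List (Link n p)
  -- `upTo (suc p)` runs from 0 to `p`; for weight 0, and for endpoints not in increasing order,
  -- `linksFrom` returns the empty list.
  allLinks = concatMap (λ u → concatMap (λ v → concatMap (linksFrom u v) (upTo (suc p)))
                                        (allFin n))
                       (allFin n)

  ∈-allLinks : ∀ e → e ∈ allLinks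
  ∈-allLinks e =
    ∈-concatMap⁺ _ (lose (∈-allFin (end₁ e))
      (∈-concatMap⁺ _ (lose (∈-allFin (end₂ e))
        (∈-concatMap⁺ _ (lose (∈-upTo⁺ (s≤s (weight≤p e))) (∈-linksFrom e))))))

  linkLists : ℕ → List (List (Link n p))
  linkLists zero    = [] ∷ []
  linkLists (suc k) = [] ∷ cartesianProductWith _∷_ allLinks (linkLists k)

  -- Every link weighs at least 1, so weight at most `k` forces length at most `k`. Hence an optimum
  -- can be sought in a finite list.
  ∈-linkLists : ∀ k F → weightOf F ≤ k → F ∈ linkLists k
  ∈-linkLists zero    []      _   = here refl
  ∈-linkLists (suc k) []      _   = here refl
  ∈-linkLists zero    (e ∷ F) w≤0 =
    contradiction (ℕ.≤-trans (weight≥1 e) (ℕ.m+n≤o⇒m≤o (weight e) w≤0)) λ ()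
  ∈-linkLists (suc k) (e ∷ F) w≤k = there (∈-cartesianProductWith⁺ _∷_ (∈-allLinks e)
    (∈-linkLists k F (ℕ.≤-pred (ℕ.≤-trans (ℕ.+-monoˡ-≤ (weightOf F) (weight≥1 e)) w≤k))))

-- Two-edge-connectivity as covering of the tree cuts.

module Covering {n p : ℕ} (E : Edges n) (tree : IsTree E) where
  open Tree E tree

  Covers : Link n p → Fin (length E) → Set
  Covers f i = Cross i (end₁ f) (end₂ f)

  covers? : ∀ f → Decidable (Covers f)
  covers? f i = cross? i (end₁ f) (end₂ f)

  Covers⇒Cross : ∀ {f u v i} → Between f u v → Covers f i → Cross i u v
  Covers⇒Cross (inj₁ (refl , refl)) = id
  Covers⇒Cross (inj₂ (refl , refl)) = _∘ sym

  Cross⇒Covers : ∀ {f u v i} → Between f u v → Cross i u v → Covers f i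
  Cross⇒Covers (inj₁ (refl , refl)) = id
  Cross⇒Covers (inj₂ (refl , refl)) = _∘ sym

  -- An edge on a path between the ends of `f` is crossed by `f`, hence by `e`, and a crossed edge
  -- lies on every walk between the ends of `e`, in particular on the loop-erased one.
  Covers⊆⇒Shadow : ∀ {e f} → weight e ≤ weight f → (∀ i → Covers f i → Covers e i) → Shadow E f e
  Covers⊆⇒Shadow {e} w≤ f⊆e = w≤ , λ where
    i (π , p , i∈π) → let ρ , q = loopErase (proj₁ tree (end₁ e) (end₂ e)) in
      ρ , q , Cross⇒∈edges ρ (f⊆e i (∈path⇒Cross π p i∈π))

  -- Distinctness of the links is left out because an exchange may insert a link that is already
  -- present; `Cover⇒Feasible` restores it.
  Cover : List (Link n p) → Set
  Cover F = weightOf F ≤ p × (∀ i → Any (λ f → Covers f i) F)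

  cover? : Decidable Cover
  cover? F = weightOf F ≤? p ×-dec Fin.all? (λ i → any? (λ f → covers? f i) F)

  -- If no link covered `i`, then `side i` would be constant along every walk of the union that
  -- avoids `i`, yet such a walk joins the ends of `i`.
  Feasible⇒Cover : ∀ {F} → Feasible E F → Cover F
  Feasible⇒Cover {F} (_ , w≤p , _ , robust) = w≤p , covered
    where
    covered : ∀ i → Any (λ f → Covers f i) F
    covered i with any? (λ f → covers? f i) F
    ... | yes i-covered = i-covered
    ... | no ¬covered = contradiction
      (invariant (side i) constant (robust (inj₁ i) (proj₁ (ends i)) (proj₂ (ends i))))
      (edge-crosses-itself (inj₁ (refl , refl)))
      where
      constant : ∀ j → j ≢ inj₁ i → ∀ {u v} → Joins (unionEnds E F j) u v → side i u ≡ side i v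
      constant (inj₁ j) j≢i J = edge-crosses-only-itself (j≢i ∘ cong inj₁) J
      constant (inj₂ k) _ {u} {v} J with side i u Bool.≟ side i v
      ... | yes eq = eq
      ... | no u×v =
        contradiction (lose (∈-lookup k) (Cross⇒Covers {lookup F k} J u×v)) ¬covered

  -- Deleting a link leaves the whole tree. Deleting a tree edge leaves its two sides, each
  -- connected, and a covering link joins them.
  Cover⇒TwoEdgeConnected : ∀ {F} → Cover F → TwoEdgeConnected (unionEnds E F)
  Cover⇒TwoEdgeConnected {F} (_ , covered) =
    (λ u v → mapʷ inj₁ (λ _ → refl) (λ _ → id) (proj₁ tree u v)) , robust
    where
    robust : ∀ i → Connected (unionEnds E F) (_≢ i)
    robust (inj₂ k) u v = mapʷ inj₁ (λ _ → refl) (λ _ _ ()) (proj₁ tree u v)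
    robust (inj₁ i) u v = connect
      where
      lift : ∀ {u v} → side i u ≡ side i v → Walk (unionEnds E F) (_≢ inj₁ i) u v
      lift eq = mapʷ inj₁ (λ _ → refl) (λ { _ j≢i refl → j≢i refl }) (side≡⇒Avoiding eq)

      k = Any.index (covered i)
      x = end₁ (lookup F k)
      y = end₂ (lookup F k)
      x×y : Cross i x y
      x×y = Any.lookup-index (covered i)

      connect : Walk (unionEnds E F) (_≢ inj₁ i) u v
      connect with side i u Bool.≟ side i v | side i u Bool.≟ side i x
      -- The covering link `k` is traversed from `x` to `y` if `u` lies on the side of `x`, and
      -- backwards otherwise.
      ... | yes uv | _      = lift uv
      ... | no u×v | yes ux = lift ux ++ʷ step (inj₂ k) (λ ()) (inj₁ (refl , refl))
        (lift (Bool-≢≢⇒≡ (x×y ∘ sym) (u×v ∘ ≡.trans ux)))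
      ... | no u×v | no u×x = lift (Bool-≢≢⇒≡ u×x x×y) ++ʷ
        step (inj₂ k) (λ ()) (inj₂ (refl , refl)) (lift (Bool-≢≢⇒≡ (u×x ∘ sym) u×v))

  Cover⇒Feasible : ∀ {F} → Cover F → Feasible E (deduplicate _≟ˡ_ F)
  Cover⇒Feasible {F} (w≤p , covered) =
    Unique.deduplicate-! _≟ˡ_ F , w≤p′ , Cover⇒TwoEdgeConnected (w≤p′ , covered′)
    where
    w≤p′ = ℕ.≤-trans (Costs.costOf-deduplicate ℕ-costs weight _≟ˡ_ F) w≤p
    covered′ : ∀ i → Any (λ f → Covers f i) (deduplicate _≟ˡ_ F)
    covered′ i with find (covered i)
    ... | f , f∈F , f-covers = lose (∈-deduplicate⁺ _≟ˡ_ f∈F) f-covers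

  -- This is the length of the tree path of `f`.
  coverage : Link n p → ℕ
  coverage f = length (filter (covers? f) (allFin (length E)))

  -- Counting the link itself as well makes merging two links decrease the size.
  size : List (Link n p) → ℕ
  size = costOf ℕ-costs (suc ∘ coverage)

  module W = Costs ℕ-costs {n} {p} weight
  module S = Costs ℕ-costs {n} {p} (suc ∘ coverage)

  -- Exchanges that do not raise the cost.

  module Improving (D : CostDomain) (c : Link n p → CostDomain.Cost D) (metric : Metric D E c) where
    open CostDomain D using (Cost; _≤ᶜ_; _+ᶜ_; ≤-refl; ≤-trans; 0-least; +-monoˡ-≤)
    open Costs D c

    cost : List (Link n p) → Cost
    cost = costOf D c

    Improvement : List (Link n p) → Set
    Improvement F = ∃ λ F′ → Cover F′ × cost F′ ≤ᶜ cost F × size F′ < size F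

    -- Whatever `rest` covers stays covered, so only the edges covered by `old` need checking, and
    -- `rest` may help with those too.
    replace : ∀ {F} old new {rest} → F ↭ old ++ rest → Cover F →
      (∀ i → Any (λ f → Covers f i) old → Any (λ f → Covers f i) (new ++ rest)) →
      cost new ≤ᶜ cost old → weightOf new ≤ weightOf old → size new < size old →
      Improvement F
    replace {F} old new {rest} F↭ (w≤p , covered) old⊆new c≤ w≤ s< =
      new ++ rest
      , (ℕ.≤-trans (W.costOf-replace old new F↭ w≤) w≤p
        , λ i → [ old⊆new i , Any.++⁺ʳ new ]′ (Any.++⁻ old (Any-resp-↭ F↭ (covered i))))
      , costOf-replace old new F↭ c≤
      , size<
      where
      size< : size (new ++ rest) < size F
      size< rewrite S.costOf-↭ F↭ | S.costOf-++ old rest | S.costOf-++ new rest =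
        ℕ.+-monoˡ-< (size rest) s<

    Cross-triangle : ∀ {i} u {v w} → Cross i v w → Cross i u v ⊎ Cross i u w
    Cross-triangle {i} u {v} {w} v×w with side i u Bool.≟ side i v
    ... | no u×v = inj₁ u×v
    ... | yes uv = inj₂ (v×w ∘ ≡.trans (sym uv))

    -- The tree paths of `e` and `f` leave `v` along different edges, so they are disjoint and
    -- together form the path from `x` to `z`. The second metric condition then bounds the cost of
    -- the merged link.
    merge : ∀ {F v i j e f x z rest} → Cover F → F ↭ e ∷ f ∷ rest → DegreeTwo v i j →
      Between e v x → Between f v z → Cross i v x → side j v ≡ side j x → Cross j v z →
      side i v ≡ side i z → Improvement F
    merge {F} {v} {i} {j} {e} {f} {x} {z} {rest} cover F↭ d Be Bf ix jx jz iz
      -- The ends `x` and `z` are distinct because `i` separates `x`, but not `z`, from `v`. The new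
      -- weight is at most `p` because `e` and `f` both belong to the cover.
      with makeLink {u = x} {z} {weight e + weight f} (λ { refl → ix iz })
             (ℕ.≤-trans (weight≥1 e) (ℕ.m≤m+n _ _)) we+wf≤p
      where
      we+wf≤p : weight e + weight f ≤ p
      we+wf≤p = ℕ.≤-trans (ℕ.+-monoʳ-≤ (weight e) (ℕ.m≤m+n (weight f) (weightOf rest)))
        (subst (_≤ p) (W.costOf-↭ F↭) (proj₁ cover))
    ... | h , Bh , wh = replace (e ∷ f ∷ []) (h ∷ []) F↭ cover covers cost≤ weight≤ size<
      where
      open DegreeTwo d

      covers : ∀ k → Any (λ f → Covers f k) (e ∷ f ∷ []) → Any (λ f → Covers f k) (h ∷ rest)
      -- An edge `k` crossed by `e` is not crossed by `f`, so `z` is on the side of `v` while `x` is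
      -- not.
      covers k (here ek) = here (Cross⇒Covers {h} Bh
        (λ xz → kx (≡.trans (crossings-disjoint (proj₂ fst) ix iz k kx) (sym xz))))
        where kx = Covers⇒Cross {e} Be ek
      covers k (there (here fk)) = here (Cross⇒Covers {h} Bh
        (λ xz → kz (≡.trans (crossings-disjoint (proj₂ snd) jz jx k kz) xz)))
        where kz = Covers⇒Cross {f} Bf fk

      cost≤ : cost (h ∷ []) ≤ᶜ cost (e ∷ f ∷ [])
      cost≤ rewrite costOf-singleton h | costOf-singleton f =
        proj₂ metric e f h x v z (Joins-sym Be) Bf Bh (ℕ.≤-reflexive (sym wh))

      weight≤ : weightOf (h ∷ []) ≤ weightOf (e ∷ f ∷ [])
      weight≤ rewrite W.costOf-singleton h | W.costOf-singleton f = ℕ.≤-reflexive wh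

      coverage≤ : coverage h ≤ coverage e + coverage f
      coverage≤ = length-filter-∪ (covers? h) (covers? e) (covers? f)
        (λ hk → Sum.map (Cross⇒Covers {e} Be) (Cross⇒Covers {f} Bf)
                        (Cross-triangle v (Covers⇒Cross {h} Bh hk)))
        (allFin _)

      size< : size (h ∷ []) < size (e ∷ f ∷ [])
      size< rewrite S.costOf-singleton h | S.costOf-singleton f | ℕ.+-suc (coverage e) (coverage f) =
        s≤s (s≤s coverage≤)

    -- Moving the end of `e` from `v` across `i` to `u` gives up the coverage of `i` alone, and `f`
    -- still covers `i`. The first metric condition bounds the cost.
    shorten : ∀ {F v u i e f x rest} → Cover F → F ↭ e ∷ rest → Joins (ends i) v u →
      Between e v x → Cross i v x → f ∈ rest → Covers f i → Improvement F
    shorten {F} {v} {u} {i} {e} {f} {x} {rest} cover F↭ J Be ix f∈ fi with u ≟ x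
    -- Here `e` is parallel to `i` and covers nothing else, so it is simply dropped.
    ... | yes refl = replace (e ∷ []) [] F↭ cover covers (0-least _) z≤n (s≤s z≤n)
      where
      covers : ∀ k → Any (λ f → Covers f k) (e ∷ []) → Any (λ f → Covers f k) rest
      covers k (here ek) with i ≟ k
      ... | yes refl = lose f∈ fi
      ... | no i≢k = contradiction (edge-crosses-only-itself i≢k J) (Covers⇒Cross {e} Be ek)
    ... | no u≢x with makeLink u≢x (weight≥1 e) (weight≤p e)
    ...   | h , Bh , wh = replace (e ∷ []) (h ∷ []) F↭ cover covers cost≤ weight≤ size<
      where
      iu : Cross i v u
      iu = edge-crosses-itself J

      covers : ∀ k → Any (λ f → Covers f k) (e ∷ []) → Any (λ f → Covers f k) (h ∷ rest)
      covers k (here ek) with i ≟ k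
      ... | yes refl = there (lose f∈ fi)
      ... | no i≢k = here (Cross⇒Covers {h} Bh
        (Covers⇒Cross {e} Be ek ∘ ≡.trans (edge-crosses-only-itself i≢k J)))

      ¬hi : ¬ Covers h i
      -- Both `u` and `x` lie on the side of `i` opposite to `v`. The loss of `i` is what makes the
      -- size strictly smaller.
      ¬hi hi = Covers⇒Cross {h} Bh hi (Bool-≢≢⇒≡ (iu ∘ sym) ix)

      h⊆e : ∀ {k} → Covers h k → Covers e k
      h⊆e {k} hk with i ≟ k
      ... | yes refl = contradiction hk ¬hi
      ... | no i≢k = Cross⇒Covers {e} Be
        (Covers⇒Cross {h} Bh hk ∘ ≡.trans (sym (edge-crosses-only-itself i≢k J)))

      cost≤ : cost (h ∷ []) ≤ᶜ cost (e ∷ [])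
      cost≤ = +-monoˡ-≤ _
        (proj₁ metric e h (Covers⊆⇒Shadow {e} {h} (ℕ.≤-reflexive (sym wh)) (λ _ → h⊆e)))

      weight≤ : weightOf (h ∷ []) ≤ weightOf (e ∷ [])
      weight≤ = ℕ.+-monoˡ-≤ 0 (ℕ.≤-reflexive wh)

      size< : size (h ∷ []) < size (e ∷ [])
      size< = ℕ.+-monoˡ-< 0 (s≤s (length-filter-strict (covers? h) (covers? e) h⊆e
        (∈-allFin i) ¬hi (Cross⇒Covers {e} Be ix)))

    improve-crossing : ∀ {F v i j e x} → Cover F → e ∈ F → DegreeTwo v i j → Between e v x →
      Cross i v x → side j v ≡ side j x → Improvement F
    improve-crossing {F} {v} {i} {j} {e} {x} cover e∈F d Be ix jx
      with ∈⇒↭ e∈F | find (proj₂ cover j)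
    ... | rest , F↭ | f , f∈F , fj = go (end₁ f ≟ v) (end₂ f ≟ v)
      where
      f∈rest : f ∈ rest
      f∈rest with ∈-resp-↭ F↭ f∈F
      -- The link `f` covers `j` and `e` does not, so `f` is found among the remaining links.
      ... | here refl = contradiction jx (Covers⇒Cross {e} Be fj)
      ... | there f∈  = f∈

      shared : ∀ {z} → Between f v z → Improvement F
      shared Bf with crosses-one d (λ { refl → Covers⇒Cross {f} Bf fj refl })
      ... | inj₁ (_ , jz)  = contradiction jz (Covers⇒Cross {f} Bf fj)
      ... | inj₂ (jz , iz) with ∈⇒↭ f∈rest
      ...   | rest′ , rest↭ = merge cover (trans F↭ (prep e rest↭)) d Be Bf ix jx jz iz

      -- Each end of `f` is separated from `v` by exactly one of `i` and `j`. As `f` crosses `j`,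
      -- its ends lie in different branches at `v`, so `i` separates them as well.
      covers-i : end₁ f ≢ v → end₂ f ≢ v → Covers f i
      covers-i s≢v t≢v with crosses-one d (s≢v ∘ sym) | crosses-one d (t≢v ∘ sym)
      ... | inj₁ (_ , js)  | inj₁ (_ , jt)  = contradiction (≡.trans (sym js) jt) fj
      ... | inj₁ (is , _)  | inj₂ (_ , it)  = is ∘ ≡.trans it ∘ sym
      ... | inj₂ (_ , is)  | inj₁ (it , _)  = it ∘ ≡.trans is
      ... | inj₂ (js , _)  | inj₂ (jt , _)  = contradiction (Bool-≢≢⇒≡ (js ∘ sym) jt) fj

      go : Dec (end₁ f ≡ v) → Dec (end₂ f ≡ v) → Improvement F
      go (yes s≡v) _         = shared (inj₁ (s≡v , refl))
      go (no _)    (yes t≡v) = shared (inj₂ (refl , t≡v))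
      go (no s≢v)  (no t≢v)  =
        shorten cover F↭ (proj₂ (DegreeTwo.fst d)) Be ix f∈rest (covers-i s≢v t≢v)

    improve : ∀ {F v x e} → Cover F → e ∈ F → Between e v x → v ≢ x → ¬ Corner E v →
              Improvement F
    improve cover e∈F Be v≢x ¬corner with ¬Corner⇒DegreeTwo v≢x ¬corner
    ... | i , j , d with crosses-one d v≢x
    ...   | inj₁ (ix , jx) = improve-crossing cover e∈F d Be ix jx
    ...   | inj₂ (jx , ix) = improve-crossing cover e∈F (DegreeTwo-sym d) Be jx ix

    -- Reaching corner nodes, and choosing an optimum.

    CornerLink : Link n p → Set
    CornerLink e = Corner E (end₁ e) × Corner E (end₂ e)

    corner? : Decidable (Corner E)
    corner? v = degree E v ℕ.≟ 1 ⊎-dec 3 ≤? degree E v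

    cornerLink? : Decidable CornerLink
    cornerLink? e = corner? (end₁ e) ×-dec corner? (end₂ e)

    improveLink : ∀ {F e} → Cover F → e ∈ F → ¬ CornerLink e → Improvement F
    improveLink {e = e} cover e∈F ¬corner with corner? (end₁ e) | corner? (end₂ e)
    ... | yes p | yes q = contradiction (p , q) ¬corner
    ... | no ¬p | _     =
      improve cover e∈F (inj₁ (refl , refl)) (Fin.<⇒≢ (ordered e)) ¬p
    ... | yes _ | no ¬q =
      improve cover e∈F (inj₂ (refl , refl)) (Fin.<⇒≢ (ordered e) ∘ sym) ¬q

    -- Any link violating the corner condition permits an improvement, and the strict decrease of
    -- `size` makes the recursion well founded.
    toCorners : ∀ F → Acc _<_ (size F) → Cover F →
                ∃ λ F′ → Cover F′ × cost F′ ≤ᶜ cost F × All CornerLink F′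
    toCorners F (acc smaller) cover with All.all? cornerLink? F
    ... | yes corners = F , cover , ≤-refl , corners
    ... | no ¬corners with find (All.¬All⇒Any¬ cornerLink? F ¬corners)
    ...   | e , e∈F , ¬corner with improveLink cover e∈F ¬corner
    ...     | F′ , cover′ , F′≤F , size< with toCorners F′ (smaller size<) cover′
    ...       | F″ , cover″ , F″≤F′ , corners = F″ , cover″ , ≤-trans F″≤F′ F′≤F , corners

    cheapestCover : ∃ Cover → ∃ λ F → Cover F × (∀ G → Cover G → cost F ≤ᶜ cost G)
    -- `F₀` is the default value of `argmin`, so the result is a cover even before anything is known
    -- about the enumerated list.
    cheapestCover (F₀ , cover₀) = argmin cost F₀ covers
      , argmin-all cost cover₀ (All.all-filter cover? (linkLists p))
      , λ G coverG → All.lookup (f[argmin]≤f[xs] F₀ covers)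
          (∈-filter⁺ cover? (∈-linkLists p G (proj₁ coverG)) coverG)
      where
      open Extrema totalOrder
      covers = filter cover? (linkLists p)

theorem5 : (D : CostDomain) → (n p : ℕ) → 1 ≤ p → (E : Edges n) → IsTree E →
    (c : Link n p → CostDomain.Cost D) → Metric D E c →
    Σ (List (Link n p)) (Feasible E) →
    Σ (List (Link n p)) (λ F →
    Feasible E F ×
    (∀ F′ → Feasible E F′ → CostDomain._≤ᶜ_ D (costOf D c F) (costOf D c F′)) ×
    (∀ e → e ∈ F → Corner E (end₁ e) × Corner E (end₂ e)))
theorem5 D n p _ E tree c metric (F₀ , feasible₀) =
  let open CostDomain D
      open Covering E tree
      open Improving D c metric
      -- The minimum is taken over all covers, which include all feasible sets. Neither the
      -- exchanges nor the final removal of duplicates raises the cost, so optimality survives.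
      F , cover , minimal = cheapestCover (F₀ , Feasible⇒Cover feasible₀)
      G , coverG , G≤F , corners = toCorners F (<-wellFounded _) cover
  in deduplicate _≟ˡ_ G
   , Cover⇒Feasible coverG
   , (λ F′ feasible′ → ≤-trans (Costs.costOf-deduplicate D c _≟ˡ_ G)
       (≤-trans G≤F (minimal F′ (Feasible⇒Cover feasible′))))
   , λ e e∈ → All.lookup corners (∈-deduplicate⁻ _≟ˡ_ G e∈)
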